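{- For any resumptions $r$ and $r_*$, if $r\cong_{\mathrm c} r_*$ (classical-style weak bisimilarity), then $r\cong r_*$ (constructive-style weak bisimilarity). Classically (i.e. assuming excluded middle), for any resumptions $r$ and $r_*$, if $r\cong r_*$, then $r\cong_{\mathrm c} r_*$.
   Context: The ambient logic is constructive type theory; "classically" means that excluded middle is additionally assumed. States $\sigma$ map variables to integers. Resumptions $r:\mathit{res}$ are defined coinductively by the constructors $\mathit{ret}~\sigma$ ($\sigma$ a state), $\mathit{in}~f$ ($f:\mathbb Z\to\mathit{res}$), $\mathit{out}~v~r$ ($v\in\mathbb Z$, $r:\mathit{res}$), and $\delta~r$ ($r:\mathit{res}$, an internal/delay step). Strong bisimilarity $r\approx r_*$ is defined coinductively by: $\mathit{ret}~\sigma\approx\mathit{ret}~\sigma$; $\mathit{in}~f\approx\mathit{in}~f_*$ if $\forall v.\,f\,v\approx f_*\,v$; $\mathit{out}~v~r\approx\mathit{out}~v~r_*$ if $r\approx r_*$; $\delta~r\approx\delta~r_*$ if $r\approx r_*$. Strongly bisimilar resumptions count as equal (resumptions form a setoid with equality $\approx$). Convergence $r\downarrow r'$ is defined inductively: $\mathit{ret}~\sigma\downarrow\mathit{ret}~\sigma$; $\mathit{in}~f\downarrow\mathit{in}~f_*$ if $\forall v.\,f\,v\approx f_*\,v$; $\mathit{out}~v~r\downarrow\mathit{out}~v~r_*$ if $r\approx r_*$; $\delta~r\downarrow r'$ if $r\downarrow r'$. Divergence $r\uparrow$ is defined coinductively: $(\delta~r)\uparrow$ if $r\uparrow$. Weak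 bisimilarity $r\cong r_*$ is defined coinductively by four rules: (1) $r\cong r_*$ if $r\downarrow\mathit{ret}~\sigma$ and $r_*\downarrow\mathit{ret}~\sigma$; (2) $r\cong r_*$ if $r\downarrow\mathit{in}~f$, $r_*\downarrow\mathit{in}~f_*$ and $\forall v.\,f\,v\cong f_*\,v$; (3) $r\cong r_*$ if $r\downarrow\mathit{out}~v~r'$, $r_*\downarrow\mathit{out}~v~r_*'$ and $r'\cong r'_*$; (4) $\delta~r\cong\delta~r_*$ if $r\cong r_*$. Classical-style weak bisimilarity $r\cong_{\mathrm c} r_*$ is defined coinductively by rules (1)–(3) with $\cong_{\mathrm c}$ in place of $\cong$, and (4') $r\cong_{\mathrm c} r_*$ if $r\uparrow$ and $r_*\uparrow$. -}

module Defs where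

open import Data.Integer.Base using (ℤ)
open import Data.Product.Base using (_×_; ∃-syntax)
open import Level using (0ℓ; suc; _⊔_)
open import Relation.Binary.Core using (Rel; _⇒_)
open import Relation.Unary using (Pred; _⊆_)

State : Set → Set
State Var = Var → ℤ

-- Every recursive occurrence passes through the coinductive record ∞Res, so
-- Res is the coinductive type with the four constructors ret, inp, out and δ;
-- ∞Res only marks the places where the unfolding may continue forever.
mutual

  data Res (Var : Set) : Set where
    ret : State Var → Res Var
    inp : (ℤ → ∞Res Var) → Res Var
    out : ℤ → ∞Res Var → Res Var
    δ   : ∞Res Var → Res Var

  record ∞Res (Var : Set) : Set where
    coinductive
    field
      ♭ : Res Var

open ∞Res public

private
  variable
    Var : Set

-- Corecursive proofs need --guardedness, which is not switched on here.  A
-- coinductively defined predicate or relation is therefore given as the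
-- greatest one closed backwards under its rules, that is, as the union of all
-- post-fixed points of the operator that sends R to the conclusions derivable
-- by one rule from premises in R.  Quantifying over R raises the level to 1;
-- post-fixed points at level 0 are enough, since the corresponding native
-- coinductive families live in Set.

ν₁ : {A : Set} → (Pred A 0ℓ → Pred A 0ℓ) → Pred A (suc 0ℓ)
ν₁ {A} F x = ∃[ P ] (P ⊆ F P) × P x

ν₂ : ∀ {A : Set} {ℓ} → (Rel A 0ℓ → Rel A ℓ) → Rel A (suc 0ℓ ⊔ ℓ)
ν₂ {A} F x y = ∃[ R ] (R ⇒ F R) × R x y

infix 4 _≈_ _↓_ _≅_ _≅ᶜ_
infix 5 _↑

data StrongRules (R : Rel (Res Var) 0ℓ) : Rel (Res Var) 0ℓ where
  ret : ∀ {σ} → StrongRules R (ret σ) (ret σ)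
  inp : ∀ {f f*} → (∀ v → R (♭ (f v)) (♭ (f* v))) →
        StrongRules R (inp f) (inp f*)
  out : ∀ {v r r*} → R (♭ r) (♭ r*) → StrongRules R (out v r) (out v r*)
  δ   : ∀ {r r*} → R (♭ r) (♭ r*) → StrongRules R (δ r) (δ r*)

_≈_ : Rel (Res Var) (suc 0ℓ)
_≈_ = ν₂ StrongRules

data _↓_ {Var : Set} : Rel (Res Var) (suc 0ℓ) where
  ret : ∀ {σ} → ret σ ↓ ret σ
  inp : ∀ {f f*} → (∀ v → ♭ (f v) ≈ ♭ (f* v)) → inp f ↓ inp f*
  out : ∀ {v r r*} → ♭ r ≈ ♭ r* → out v r ↓ out v r*
  δ   : ∀ {r r′} → ♭ r ↓ r′ → δ r ↓ r′

data DivergenceRule (P : Pred (Res Var) 0ℓ) : Pred (Res Var) 0ℓ where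
  δ : ∀ {r} → P (♭ r) → DivergenceRule P (δ r)

_↑ : Pred (Res Var) (suc 0ℓ)
_↑ = ν₁ DivergenceRule

data WeakRules (R : Rel (Res Var) 0ℓ) : Rel (Res Var) (suc 0ℓ) where
  ret : ∀ {r r* σ} → r ↓ ret σ → r* ↓ ret σ → WeakRules R r r*
  inp : ∀ {r r* f f*} → r ↓ inp f → r* ↓ inp f* →
        (∀ v → R (♭ (f v)) (♭ (f* v))) → WeakRules R r r*
  out : ∀ {r r* v r′ r*′} → r ↓ out v r′ → r* ↓ out v r*′ →
        R (♭ r′) (♭ r*′) → WeakRules R r r*
  δ   : ∀ {r r*} → R (♭ r) (♭ r*) → WeakRules R (δ r) (δ r*)

_≅_ : Rel (Res Var) (suc 0ℓ)
_≅_ = ν₂ WeakRules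

data ClassicalWeakRules (R : Rel (Res Var) 0ℓ) : Rel (Res Var) (suc 0ℓ) where
  ret : ∀ {r r* σ} → r ↓ ret σ → r* ↓ ret σ → ClassicalWeakRules R r r*
  inp : ∀ {r r* f f*} → r ↓ inp f → r* ↓ inp f* →
        (∀ v → R (♭ (f v)) (♭ (f* v))) → ClassicalWeakRules R r r*
  out : ∀ {r r* v r′ r*′} → r ↓ out v r′ → r* ↓ out v r*′ →
        R (♭ r′) (♭ r*′) → ClassicalWeakRules R r r*
  div : ∀ {r r*} → r ↑ → r* ↑ → ClassicalWeakRules R r r*

_≅ᶜ_ : Rel (Res Var) (suc 0ℓ)
_≅ᶜ_ = ν₂ ClassicalWeakRules

{-# OPTIONS --safe #-}
-- A pair of divergent resumptions can be matched forever by rule (4), which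
-- gives the first inclusion.  Conversely, excluded middle decides whether one
-- of the two resumptions halts: if so, only finitely many applications of
-- rule (4) can precede one of the rules (1)–(3), and they are absorbed into the
-- convergence premises of that rule; if not, both diverge and (4') applies.
module Submission where

open import Defs
open import Axiom.ExcludedMiddle using (ExcludedMiddle)
open import Data.Empty using (⊥)
open import Data.Nat.Base using (ℕ; zero; suc)
open import Data.Product.Base using (_×_; _,_)
open import Data.Sum.Base using (_⊎_; inj₁; inj₂)
open import Data.Unit.Base using (⊤; tt)
open import Function.Base using (_∘_)
open import Level using (0ℓ)
open import Relation.Binary.Core using (Rel; _⇒_)
open import Relation.Nullary using (¬_; yes; no; contradiction)
open import Relation.Unary using (Pred; _⊆_)

private
  variable
    Var : Set
    R S : Rel (Res Var) 0ℓ

Delays : ℕ → Pred (Res Var) 0ℓ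
Delays zero    _     = ⊤
Delays (suc n) (δ r) = Delays n (♭ r)
Delays (suc n) _     = ⊥

-- A post-fixed point for weak bisimilarity must be a relation at level 0,
-- whereas _↑ is at level 1; Diverges is its counterpart at level 0.
Diverges : Pred (Res Var) 0ℓ
Diverges r = ∀ n → Delays n r

↑⇒Diverges : {r : Res Var} → r ↑ → Diverges r
↑⇒Diverges _               zero    = tt
↑⇒Diverges (P , P⊆ , p) (suc n) with P⊆ p
... | δ q = ↑⇒Diverges (P , P⊆ , q) n

-- `P` need not contain `δ r`. Applying the rule once to `P` adds it, and the result is still
-- post-fixed because the rule is monotone.
δ-↑ : ∀ {r : ∞Res Var} → ♭ r ↑ → δ r ↑
δ-↑ (P , P⊆ , p) = DivergenceRule P , (λ { (δ q) → δ (P⊆ q) }) , δ p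

BothDiverge : Rel (Res Var) 0ℓ
BothDiverge r r* = Diverges r × Diverges r*

BothDiverge-postfixed : BothDiverge {Var} ⇒ WeakRules BothDiverge
-- Shifting the index strips one delay, by computation of `Delays`; on the other constructors index
-- 1 is already absurd.
BothDiverge-postfixed {x = δ _}   {y = δ _}   (d , d*) = δ (d ∘ suc , d* ∘ suc)
BothDiverge-postfixed {x = ret _}             (d , _)  = contradiction (d 1) λ ()
BothDiverge-postfixed {x = inp _}             (d , _)  = contradiction (d 1) λ ()
BothDiverge-postfixed {x = out _ _}           (d , _)  = contradiction (d 1) λ ()
BothDiverge-postfixed {x = δ _} {y = ret _}   (_ , d*) = contradiction (d* 1) λ ()
BothDiverge-postfixed {x = δ _} {y = inp _}   (_ , d*) = contradiction (d* 1) λ ()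
BothDiverge-postfixed {x = δ _} {y = out _ _} (_ , d*) = contradiction (d* 1) λ ()

WeakRules-mono : R ⇒ S → WeakRules R ⇒ WeakRules S
WeakRules-mono R⇒S (ret c c*)   = ret c c*
WeakRules-mono R⇒S (inp c c* p) = inp c c* (R⇒S ∘ p)
WeakRules-mono R⇒S (out c c* p) = out c c* (R⇒S p)
WeakRules-mono R⇒S (δ p)        = δ (R⇒S p)

≅ᶜ⇒≅ : {r r* : Res Var} → r ≅ᶜ r* → r ≅ r*
≅ᶜ⇒≅ {Var} (R , R⇒ , p) = S′ , postfixed , inj₁ p
  where
  S′ : Rel (Res Var) 0ℓ
  -- `R` may say nothing about the successors of a pair related by `div`, so these are supplied by
  -- the second summand.
  S′ r r* = R r r* ⊎ BothDiverge r r*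

  postfixed : S′ ⇒ WeakRules S′
  postfixed (inj₂ d) = WeakRules-mono inj₂ (BothDiverge-postfixed d)
  postfixed (inj₁ q) with R⇒ q
  ... | ret c c*    = ret c c*
  ... | inp c c* q′ = inp c c* (inj₁ ∘ q′)
  ... | out c c* q′ = out c c* (inj₁ q′)
  ... | div d d*    = postfixed (inj₂ (↑⇒Diverges d , ↑⇒Diverges d*))

-- Convergence without its result. Unlike `_↓_` it lives at level 0, so `ExcludedMiddle 0ℓ` can
-- decide it and its negation can witness `_↑`.
data Halts {Var : Set} : Pred (Res Var) 0ℓ where
  ret : ∀ {σ} → Halts (ret σ)
  inp : ∀ {f} → Halts (inp f)
  out : ∀ {v r} → Halts (out v r)
  δ   : ∀ {r} → Halts (♭ r) → Halts (δ r)

¬Halts⇒↑ : {r : Res Var} → ¬ Halts r → r ↑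
¬Halts⇒↑ {Var} ¬h = ¬_ ∘ Halts , postfixed , ¬h
  where
  postfixed : ¬_ ∘ Halts {Var} ⊆ DivergenceRule (¬_ ∘ Halts)
  postfixed {ret _}   ¬h = contradiction ret ¬h
  postfixed {inp _}   ¬h = contradiction inp ¬h
  postfixed {out _ _} ¬h = contradiction out ¬h
  postfixed {δ _}     ¬h = δ (¬h ∘ δ)

ClassicalWeakRules-δ : ∀ {r r* : ∞Res Var} →
  ClassicalWeakRules R (♭ r) (♭ r*) → ClassicalWeakRules R (δ r) (δ r*)
ClassicalWeakRules-δ (ret c c*)   = ret (δ c) (δ c*)
ClassicalWeakRules-δ (inp c c* p) = inp (δ c) (δ c*) p
ClassicalWeakRules-δ (out c c* p) = out (δ c) (δ c*) p
ClassicalWeakRules-δ (div d d*)   = div (δ-↑ d) (δ-↑ d*)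

-- Induction on the halting proof. Rule `δ` strips a delay from both sides at once, so halting of
-- either side bounds its consecutive uses.
Halts⇒ClassicalWeakRules : R ⇒ WeakRules R → ∀ {r r* : Res Var} →
  Halts r ⊎ Halts r* → R r r* → ClassicalWeakRules R r r*
Halts⇒ClassicalWeakRules R⇒ h p with R⇒ p | h
... | ret c c*   | _          = ret c c*
... | inp c c* q | _          = inp c c* q
... | out c c* q | _          = out c c* q
... | δ q        | inj₁ (δ h′) =
  ClassicalWeakRules-δ (Halts⇒ClassicalWeakRules R⇒ (inj₁ h′) q)
... | δ q        | inj₂ (δ h′) =
  ClassicalWeakRules-δ (Halts⇒ClassicalWeakRules R⇒ (inj₂ h′) q)

≅⇒≅ᶜ : ExcludedMiddle 0ℓ → {r r* : Res Var} → r ≅ r* → r ≅ᶜ r*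
≅⇒≅ᶜ em (R , R⇒ , p) = R , postfixed , p
  where
  postfixed : R ⇒ ClassicalWeakRules R
  postfixed {r} {r*} q with em {Halts r ⊎ Halts r*}
  ... | yes h = Halts⇒ClassicalWeakRules R⇒ h q
  ... | no ¬h = div (¬Halts⇒↑ (¬h ∘ inj₁)) (¬Halts⇒↑ (¬h ∘ inj₂))

lemma3p4 : (Var : Set) →
    ((r r* : Res Var) → r ≅ᶜ r* → r ≅ r*) ×
    (ExcludedMiddle 0ℓ → (r r* : Res Var) → r ≅ r* → r ≅ᶜ r*)
lemma3p4 Var = (λ _ _ → ≅ᶜ⇒≅) , (λ em _ _ → ≅⇒≅ᶜ em)
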